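{- Let $n\ge 2$ and $d\ge 1$ be integers, and let $u_1,\dots,u_n\in(2\mathbb{Z}_{\ge 0})^n$ be points each of whose coordinate sums equals $2d$, such that $\mathcal U=\mathrm{conv}\{u_1,\dots,u_n\}$ is an $(n-1)$-dimensional simplex (i.e. $u_1,\dots,u_n$ are affinely independent). Then for every integer $k\ge \max\{2,n-2\}$, the set $k\mathcal U\cap\mathbb{Z}^n$ is $(k\mathcal U)$-mediated.
   Context: For a simplex $\mathcal V=\mathrm{conv}\{v_1,\dots,v_n\}$ with vertices $v_i\in(2\mathbb{Z})^n$, a set $S\subseteq \mathcal V\cap\mathbb{Z}^n$ containing all vertices $v_i$ is called $\mathcal V$-mediated if every $y\in S$ either equals some vertex $v_i$, or there exist $z_1\neq z_2$ in $S\cap(2\mathbb{Z})^n$ with $y=\tfrac12(z_1+z_2)$. Here $k\mathcal U=\{ku: u\in\mathcal U\}$ is the simplex with vertices $ku_1,\dots,ku_n$. -}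

module Defs where

open import Data.Nat as ℕ using (ℕ; zero; suc)
open import Data.Fin using (Fin; zero; suc)
open import Data.Integer as ℤ using (ℤ; +_)
open import Data.Integer.Divisibility using (_∣_)
open import Data.Rational as ℚ using (ℚ; 0ℚ; 1ℚ; _/_)
open import Data.Product using (Σ; ∃; _×_)
open import Relation.Binary.PropositionalEquality using (_≡_)
open import Relation.Nullary using (¬_)

Point : ℕ → Set
Point n = Fin n → ℤ

sumℚ : (m : ℕ) → (Fin m → ℚ) → ℚ
sumℚ zero    f = 0ℚ
sumℚ (suc m) f = f zero ℚ.+ sumℚ m (λ i → f (suc i))

toℚ : ℤ → ℚ
toℚ z = z / 1

InConv : {m n : ℕ} → (Fin m → Point n) → Point n → Set
InConv {m} {n} v y =
  Σ (Fin m → ℚ) λ c →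
    (∀ i → 0ℚ ℚ.≤ c i) ×
    (sumℚ m c ≡ 1ℚ) ×
    (∀ j → sumℚ m (λ i → c i ℚ.* toℚ (v i j)) ≡ toℚ (y j))

AffinelyIndependent : {m n : ℕ} → (Fin m → Point n) → Set
AffinelyIndependent {m} {n} u =
  (c : Fin m → ℚ) →
  sumℚ m c ≡ 0ℚ →
  (∀ j → sumℚ m (λ i → c i ℚ.* toℚ (u i j)) ≡ 0ℚ) →
  ∀ i → c i ≡ 0ℚ

coordSum : (n : ℕ) → Point n → ℤ
coordSum zero    x = + 0
coordSum (suc n) x = x zero ℤ.+ coordSum n (λ j → x (suc j))

Even : ℤ → Set
Even x = + 2 ∣ x

EvenPoint : {n : ℕ} → Point n → Set
EvenPoint x = ∀ j → Even (x j)

scale : {m n : ℕ} → ℕ → (Fin m → Point n) → (Fin m → Point n)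
scale k u i j = + k ℤ.* u i j

Mediated : {m n : ℕ} → (Fin m → Point n) → (Point n → Set) → Set
Mediated {m} {n} v S =
  (∀ y → S y → InConv v y) ×
  (∀ i → S (v i)) ×
  (∀ y → S y →
     (∃ λ i → ∀ j → y j ≡ v i j) ⊎′
     (Σ (Point n) λ z₁ → Σ (Point n) λ z₂ →
        S z₁ × S z₂ × EvenPoint z₁ × EvenPoint z₂ × ¬ (z₁ ≡ z₂) ×
        (∀ j → + 2 ℤ.* y j ≡ z₁ j ℤ.+ z₂ j)))
  where open import Data.Sum renaming (_⊎_ to _⊎′_)

LatticePoints : {m n : ℕ} → (Fin m → Point n) → Point n → Set
LatticePoints v y = InConv v y

{-# OPTIONS --safe #-}
-- Write y = Σ λᵢ uᵢ with Σ λᵢ = k.  Any weights 0 ≤ aᵢ ≤ 2λᵢ with Σ aᵢ = k,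
-- a ≠ λ and Σ aᵢ uᵢ an even lattice point give the midpoint representation
-- y = ½ (Σ aᵢ uᵢ + Σ (2λᵢ − aᵢ) uᵢ).  Let fᵢ = ⌊2λᵢ⌋.  If Σ fᵢ ≥ k, integral
-- weights a ≤ f exist.  Otherwise n ≤ k + 2 forces Σ fᵢ = k − 1, and
-- εᵢ = 1 − {2λᵢ} are positive weights of sum 1 with Σ εᵢ uᵢ even; some
-- multiple r of ε modulo 1 of sum 1 satisfies rᵢ + εᵢ ≤ 1, and a = f + r works.
-- All weights are handled as natural numbers over a common denominator D, and
-- uᵢ = 2wᵢ, so "even lattice point" becomes D ∣ Σ aᵢ wᵢ.
module Submission where

open import Defs
open import Data.Nat using (ℕ; _≤_; _∸_; _*_)
open import Data.Integer using (+_; _≥_)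
open import Data.Product using (_×_)
open import Data.Fin using (Fin)
open import Relation.Binary.PropositionalEquality using (_≡_)

open import Algebra.Bundles using (CommutativeMonoid)
open import Data.Fin using (zero; suc)
open import Data.Fin.Properties using (all?; ¬∀⟶∃¬)
import Data.Integer as ℤ
import Data.Integer.Properties as ℤ
open import Data.Nat using (zero; suc; _+_; _<_; NonZero; >-nonZero; >-nonZero⁻¹; z≤n; s≤s; _≤?_; _/_; _%_)
open import Data.Nat.Divisibility using (_∣_; divides; ∣⇒≤; ∣m∣n⇒∣m+n; ∣m+n∣m⇒∣n; m∣m*n)
open import Data.Nat.DivMod using (m≡m%n+[m/n]*n; m%n<n; m*n/n≡m)
open import Data.Nat.Properties
open import Data.Nat.Tactic.RingSolver using (solve-∀)
open import Data.Product using (∃; _,_; proj₁; proj₂)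
open import Data.Rational as ℚ using (ℚ; 0ℚ; 1ℚ)
import Data.Rational.Properties as ℚ
open import Data.Rational.Unnormalised as ℚᵘ using (mkℚᵘ; *≡*)
import Data.Rational.Unnormalised.Properties as ℚᵘ
open import Data.Sum using (_⊎_; inj₁; inj₂; [_,_]′)
open import Data.Vec.Functional using (Vector)
open import Function using (_∘_)
open import Relation.Binary.PropositionalEquality using (refl; sym; trans; cong; cong₂; cong-app; subst; subst₂; _≢_; module ≡-Reasoning)
open import Relation.Nullary using (¬_; yes; no; contradiction)

open import Algebra.Properties.Semiring.Sum +-*-semiring using (sum; sum-cong-≗; ∑-distrib-+; *-distribˡ-sum)
open import Algebra.Properties.CommutativeSemigroup (CommutativeMonoid.commutativeSemigroup ℚ.+-0-commutativeMonoid) using (interchange)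
open import Algebra.Properties.Group ℚ.+-0-group using (identityˡ-unique)

private variable
  m n : ℕ

-- Weighted sums of natural numbers

infixl 7 _·_

_·_ : Vector ℕ n → Vector ℕ n → ℕ
a · x = sum (λ i → a i * x i)

·-distribʳ-+ : (a b x : Vector ℕ n) → (λ i → a i + b i) · x ≡ a · x + b · x
·-distribʳ-+ a b x =
  trans (sum-cong-≗ (λ i → *-distribʳ-+ (x i) (a i) (b i)))
        (∑-distrib-+ (λ i → a i * x i) (λ i → b i * x i))

·-assoc-* : ∀ c (a x : Vector ℕ n) → (λ i → c * a i) · x ≡ c * (a · x)
·-assoc-* c a x =
  trans (sum-cong-≗ (λ i → *-assoc c (a i) (x i))) (sym (*-distribˡ-sum c (λ i → a i * x i)))

·-comm-* : ∀ c (a x : Vector ℕ n) → a · (λ i → c * x i) ≡ c * (a · x)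
·-comm-* c a x = trans (sum-cong-≗ (λ i → lemma (a i) c (x i))) (sym (*-distribˡ-sum c (λ i → a i * x i)))
  where
  lemma : ∀ a c x → a * (c * x) ≡ c * (a * x)
  lemma = solve-∀

·-congˡ : {a b : Vector ℕ n} (x : Vector ℕ n) → (∀ i → a i ≡ b i) → a · x ≡ b · x
·-congˡ x eq = sum-cong-≗ (λ i → cong (_* x i) (eq i))

sum-zero : (f : Vector ℕ n) → (∀ i → f i ≡ 0) → sum f ≡ 0
sum-zero {zero}  f f≡0 = refl
sum-zero {suc n} f f≡0 = cong₂ _+_ (f≡0 zero) (sum-zero (f ∘ suc) (f≡0 ∘ suc))

sum-single : (f : Vector ℕ n) (i : Fin n) → (∀ j → j ≢ i → f j ≡ 0) → sum f ≡ f i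
sum-single f zero off =
  trans (cong (_+_ (f zero)) (sum-zero (f ∘ suc) (λ j → off (suc j) λ ()))) (+-identityʳ _)
sum-single f (suc i) off =
  cong₂ _+_ (off zero λ ()) (sum-single (f ∘ suc) i (λ j j≢i → off (suc j) λ { refl → j≢i refl }))

·-single : (a x : Vector ℕ n) (i : Fin n) → (∀ j → j ≢ i → a j ≡ 0) → a · x ≡ a i * x i
·-single a x i off = sum-single _ i (λ j j≢i → cong (_* x j) (off j j≢i))

-- Unit weight vectors: `δ i` holds the barycentric coordinates of vertex `i`, and `D * δ i` is the
-- shift that reduces one entry modulo `D`.
δ : Fin n → Vector ℕ n
δ zero    zero    = 1
δ zero    (suc j) = 0
δ (suc i) zero    = 0
δ (suc i) (suc j) = δ i j

δ-diag : (i : Fin n) → δ i i ≡ 1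
δ-diag zero    = refl
δ-diag (suc i) = δ-diag i

δ-off : (i j : Fin n) → j ≢ i → δ i j ≡ 0
δ-off zero    zero    j≢i = contradiction refl j≢i
δ-off zero    (suc j) j≢i = refl
δ-off (suc i) zero    j≢i = refl
δ-off (suc i) (suc j) j≢i = δ-off i j (λ { refl → j≢i refl })

sum-δ : (i : Fin n) → sum (δ i) ≡ 1
sum-δ i = trans (sum-single (δ i) i (δ-off i)) (δ-diag i)

·-δ : (i : Fin n) (x : Vector ℕ n) → δ i · x ≡ x i
·-δ i x = trans (·-single (δ i) x i (δ-off i)) (trans (cong (_* x i) (δ-diag i)) (+-identityʳ _))

sum-suc : (f : Vector ℕ n) → sum (suc ∘ f) ≡ n + sum f
sum-suc {zero}  f = refl
sum-suc {suc n} f = cong suc (trans (cong (_+_ (f zero)) (sum-suc (f ∘ suc))) (lemma (f zero) n _))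
  where
  lemma : ∀ x y z → x + (y + z) ≡ y + (x + z)
  lemma = solve-∀

-- Taking as much as possible from the left leaves at most one entry cut
-- strictly between 0 and f i, which forces the last property.
greedy : (f : Vector ℕ n) (k : ℕ) → 0 < k → k ≤ sum f →
  ∃ λ (g : Vector ℕ n) → (∀ i → g i ≤ f i) × sum g ≡ k ×
    ((∀ i → 2 * g i ≡ f i) → ∃ λ i → ∀ j → j ≢ i → g j ≡ 0)
greedy {zero}  f k 0<k k≤0 = contradiction (<-≤-trans 0<k k≤0) λ ()
greedy {suc n} f k 0<k k≤Σ with k ≤? f zero
... | yes k≤f₀ = g , g≤f , trans (cong (_+_ k) (sum-zero {n} _ (λ _ → refl))) (+-identityʳ k)
               , λ _ → zero , g-off
  where
  g : Vector ℕ (suc n)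
  g zero    = k
  g (suc _) = 0
  g≤f : ∀ i → g i ≤ f i
  g≤f zero    = k≤f₀
  g≤f (suc _) = z≤n
  g-off : ∀ j → j ≢ zero → g j ≡ 0
  g-off zero    j≢0 = contradiction refl j≢0
  g-off (suc _) _   = refl
... | no k≰f₀ = g , g≤f , trans (cong (_+_ (f zero)) Σg′≡) (m+[n∸m]≡n f₀≤k) , single
  where
  f₀<k : f zero < k
  f₀<k = ≰⇒> k≰f₀
  f₀≤k : f zero ≤ k
  f₀≤k = <⇒≤ f₀<k
  rec = greedy (f ∘ suc) (k ∸ f zero) (m<n⇒0<n∸m f₀<k) (m≤n+o⇒m∸n≤o k (f zero) k≤Σ)
  g′ = proj₁ rec
  Σg′≡ = proj₁ (proj₂ (proj₂ rec))
  g : Vector ℕ (suc n)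
  g zero    = f zero
  g (suc i) = g′ i
  g≤f : ∀ i → g i ≤ f i
  g≤f zero    = ≤-refl
  g≤f (suc i) = proj₁ (proj₂ rec) i
  single : (∀ i → 2 * g i ≡ f i) → ∃ λ i → ∀ j → j ≢ i → g j ≡ 0
  single eq with proj₂ (proj₂ (proj₂ rec)) (eq ∘ suc)
  ... | i , off = suc i , off′
    where
    off′ : ∀ j → j ≢ suc i → g j ≡ 0
    -- Here `g zero` is `f zero`, so `eq zero` reads 2x = x for x = `f zero`, whence x = 0.
    off′ zero    _   = m+n≡0⇒m≡0 _ (+-cancelˡ-≡ (f zero) (f zero + 0) 0 (trans (eq zero) (sym (+-identityʳ _))))
    off′ (suc j) j≢i = off j (λ { refl → j≢i refl })

-- Halving a weight vector within the lattice

module _ (D : ℕ) .{{_ : NonZero D}} (w : Fin n → Vector ℕ m) where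

  InLattice : Vector ℕ n → Set
  InLattice a = ∀ j → D ∣ a · (λ i → w i j)

  InLattice-cong : {a b : Vector ℕ n} → (∀ i → a i ≡ b i) → InLattice a → InLattice b
  InLattice-cong eq La j = subst (D ∣_) (·-congˡ _ eq) (La j)

  InLattice-+ : (a b : Vector ℕ n) → InLattice a → InLattice b → InLattice (λ i → a i + b i)
  InLattice-+ a b La Lb j = subst (D ∣_) (sym (·-distribʳ-+ a b (λ i → w i j))) (∣m∣n⇒∣m+n (La j) (Lb j))

  -- Closure under differences, phrased as cancelling a summand because the weights are natural
  -- numbers.
  InLattice-cancel : (a b : Vector ℕ n) → InLattice (λ i → a i + b i) → InLattice a → InLattice b
  InLattice-cancel a b Lab La j = ∣m+n∣m⇒∣n (subst (D ∣_) (·-distribʳ-+ a b (λ i → w i j)) (Lab j)) (La j)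

  InLattice-D* : (g : Vector ℕ n) → InLattice (λ i → D * g i)
  InLattice-D* g j = subst (D ∣_) (sym (·-assoc-* D g _)) (m∣m*n _)

  -- Starting from r = E, repeatedly replace r by the representative of r + E
  -- modulo D whose entries still sum to D.  After t steps r ≡ t E, so at
  -- t = D every (positive) entry of r would be a multiple of D.
  module _ (2≤n : 2 ≤ n) (E : Vector ℕ n) (ΣE≡D : sum E ≡ D) (LE : InLattice E) where

    -- When `E i` is `D` minus a remainder of `P i`, the bound says that `r i` is at most this
    -- remainder, so `r` fits on top of the integral part of `P`.
    Target : Set
    Target = ∃ λ (r : Vector ℕ n) → (∀ i → r i + E i ≤ D) × sum r ≡ D × InLattice r

    -- The first entry alone is at least `D`, and the second is positive, so the sum exceeds `D`.
    multiples-too-large : (r : Vector ℕ n) → (∀ i → 0 < r i) → (∀ i → D ∣ r i) → sum r ≢ D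
    multiples-too-large = go 2≤n
      where
      go : ∀ {n} → 2 ≤ n → (r : Vector ℕ n) → (∀ i → 0 < r i) → (∀ i → D ∣ r i) → sum r ≢ D
      go (s≤s (s≤s _)) r 0<r D∣r Σr≡D = <-irrefl (sym Σr≡D) (begin-strict
        D                    ≤⟨ ∣⇒≤ {{>-nonZero (0<r zero)}} (D∣r zero) ⟩
        r zero               <⟨ m<m+n (r zero) (≤-trans (0<r (suc zero)) (m≤m+n _ _)) ⟩
        sum r                ∎)
        where open ≤-Reasoning

    orbit : ∀ fuel t → fuel + t ≡ D → (r : Vector ℕ n) → (∀ i → 0 < r i) → sum r ≡ D →
      InLattice r → (∀ i → ∃ λ s → D * s + r i ≡ t * E i) → Target
    orbit zero t t≡D r 0<r Σr≡D Lr r≡tE =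
      contradiction Σr≡D (multiples-too-large r 0<r λ i →
        let s , eq = r≡tE i in
        ∣m+n∣m⇒∣n (subst (D ∣_) (sym (trans eq (cong (_* E i) t≡D))) (m∣m*n (E i))) (m∣m*n s))
    orbit (suc fuel) t eqD r 0<r Σr≡D Lr r≡tE with all? (λ i → r i + E i ≤? D)
    ... | yes fits = r , fits , Σr≡D , Lr
    ... | no ¬fits with ¬∀⟶∃¬ _ _ (λ i → r i + E i ≤? D) ¬fits
    ...   | i , ¬fit = orbit fuel (suc t) (trans (+-suc fuel t) eqD) r′ 0<r′ Σr′≡D Lr′ r′≡
      where
      -- The entries of `r + E` sum to 2D, so taking `D` off the overflowing entry `i` restores the
      -- sum `D`. The overflow is strict, which keeps that entry positive.
      Dδ<r+E : ∀ j → D * δ i j < r j + E j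
      Dδ<r+E j with j Data.Fin.≟ i
      ... | yes refl = subst (_< r i + E i) (sym (trans (cong (D *_) (δ-diag i)) (*-identityʳ D))) (≰⇒> ¬fit)
      ... | no j≢i   = subst (_< r j + E j) (sym (trans (cong (D *_) (δ-off i j j≢i)) (*-zeroʳ D)))
                             (≤-trans (0<r j) (m≤m+n _ _))
      r′ : Vector ℕ n
      r′ j = r j + E j ∸ D * δ i j
      r′-spec : ∀ j → D * δ i j + r′ j ≡ r j + E j
      r′-spec j = m+[n∸m]≡n (<⇒≤ (Dδ<r+E j))
      0<r′ : ∀ j → 0 < r′ j
      0<r′ j = m<n⇒0<n∸m (Dδ<r+E j)
      Σr′≡D : sum r′ ≡ D
      Σr′≡D = +-cancelˡ-≡ D _ _ (begin
        D + sum r′                        ≡⟨ cong (_+ sum r′) (trans (cong (D *_) (sum-δ i)) (*-identityʳ D)) ⟨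
        D * sum (δ i) + sum r′            ≡⟨ cong (_+ sum r′) (*-distribˡ-sum D (δ i)) ⟩
        sum (λ j → D * δ i j) + sum r′    ≡⟨ ∑-distrib-+ _ r′ ⟨
        sum (λ j → D * δ i j + r′ j)      ≡⟨ sum-cong-≗ r′-spec ⟩
        sum (λ j → r j + E j)             ≡⟨ ∑-distrib-+ r E ⟩
        sum r + sum E                     ≡⟨ cong₂ _+_ Σr≡D ΣE≡D ⟩
        D + D                             ∎)
        where open ≡-Reasoning
      Lr′ : InLattice r′
      Lr′ = InLattice-cancel (λ j → D * δ i j) r′
        (InLattice-cong (λ j → sym (r′-spec j)) (InLattice-+ r E Lr LE)) (InLattice-D* (δ i))
      r′≡ : ∀ j → ∃ λ s → D * s + r′ j ≡ suc t * E j
      r′≡ j with r≡tE j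
      -- `s` counts how often `D` has been taken off entry `j`; it grows only for `j = i`.
      ... | s , eq = s + δ i j , (begin
        D * (s + δ i j) + r′ j        ≡⟨ lemma D s (δ i j) (r′ j) ⟩
        D * s + (D * δ i j + r′ j)    ≡⟨ cong (_+_ (D * s)) (r′-spec j) ⟩
        D * s + (r j + E j)           ≡⟨ lemma′ (D * s) (r j) (E j) ⟩
        E j + (D * s + r j)           ≡⟨ cong (_+_ (E j)) eq ⟩
        suc t * E j                   ∎)
        where
        open ≡-Reasoning
        lemma : ∀ D s d x → D * (s + d) + x ≡ D * s + (D * d + x)
        lemma = solve-∀
        lemma′ : ∀ x y z → x + (y + z) ≡ z + (x + y)
        lemma′ = solve-∀

  -- For `P` = 2λD, the vectors `a / D` and `b / D` are weights of two even lattice points with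
  -- midpoint Σ λᵢ uᵢ. Affine independence later turns `a` ≠ `b` into distinctness of these points.
  Halving : ℕ → Vector ℕ n → Set
  Halving s P = ∃ λ (a : Vector ℕ n) → ∃ λ (b : Vector ℕ n) →
    (∀ i → a i + b i ≡ P i) × sum a ≡ s × sum b ≡ s ×
    InLattice a × InLattice b × ¬ (∀ i → a i ≡ b i)

  module _ (P : Vector ℕ n) (LP : InLattice P) (k : ℕ) (ΣP≡2kD : sum P ≡ k * D + k * D) where

    -- The second half is the complement `P − a`: its sum and lattice membership follow by
    -- subtraction, and it equals `a` only if 2a = `P`.
    halving-from : (a : Vector ℕ n) → (∀ i → a i ≤ P i) → sum a ≡ k * D → InLattice a →
      ¬ (∀ i → 2 * a i ≡ P i) → Halving (k * D) P
    halving-from a a≤P Σa≡kD La 2a≢P =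
      a , b , a+b≡P , Σa≡kD , Σb≡kD , La , Lb ,
      λ a≡b → 2a≢P λ i → trans (cong (_+_ (a i)) (trans (+-identityʳ (a i)) (a≡b i))) (a+b≡P i)
      where
      b : Vector ℕ n
      b i = P i ∸ a i
      a+b≡P : ∀ i → a i + b i ≡ P i
      a+b≡P i = m+[n∸m]≡n (a≤P i)
      Σb≡kD : sum b ≡ k * D
      Σb≡kD = +-cancelˡ-≡ (k * D) _ _ (begin
        k * D + sum b            ≡⟨ cong (_+ sum b) Σa≡kD ⟨
        sum a + sum b            ≡⟨ ∑-distrib-+ a b ⟨
        sum (λ i → a i + b i)    ≡⟨ sum-cong-≗ a+b≡P ⟩
        sum P                    ≡⟨ ΣP≡2kD ⟩
        k * D + k * D            ∎)
        where open ≡-Reasoning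
      Lb : InLattice b
      Lb = InLattice-cancel a b (InLattice-cong (λ i → sym (a+b≡P i)) LP) La

    private
      -- For `P` = 2λD these are ⌊2λᵢ⌋, the fractional part of 2λᵢ times `D`, and εᵢD. If `D`
      -- divides `P i`, then `E i` is `D` rather than 0, so `E` is positive everywhere.
      f s E : Vector ℕ n
      f i = P i / D
      s i = P i % D
      E i = D ∸ s i

    P≡ : ∀ i → P i ≡ s i + D * f i
    P≡ i = trans (m≡m%n+[m/n]*n (P i) D) (cong (_+_ (s i)) (*-comm (f i) D))

    s+E≡D : ∀ i → s i + E i ≡ D
    s+E≡D i = m+[n∸m]≡n (<⇒≤ (m%n<n (P i) D))

    -- `E` raises `P` to the next strictly larger multiple of `D`. Thus `E` is congruent to -P
    -- modulo `D`, and it lies in the lattice because `P` does.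
    P+E≡ : ∀ i → P i + E i ≡ D * suc (f i)
    P+E≡ i = begin
      P i + E i                 ≡⟨ cong (_+ E i) (P≡ i) ⟩
      s i + D * f i + E i       ≡⟨ lemma (s i) (D * f i) (E i) ⟩
      s i + E i + D * f i       ≡⟨ cong (_+ D * f i) (s+E≡D i) ⟩
      D + D * f i               ≡⟨ *-suc D (f i) ⟨
      D * suc (f i)             ∎
      where
      open ≡-Reasoning
      lemma : ∀ x y z → x + y + z ≡ x + z + y
      lemma = solve-∀

    -- Greedy integral weights `g` give `a = D * g`. This fails only if 2Dg = `P`; then 2g = `f`, so
    -- `g` is supported at one index, and so is `P`: the vertex case.
    halving-by-greedy : 0 < k → k ≤ sum f → Halving (k * D) P ⊎ ∃ λ i → ∀ j → j ≢ i → P j ≡ 0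
    halving-by-greedy 0<k k≤Σf with greedy f k 0<k k≤Σf
    ... | g , g≤f , Σg≡k , single with all? (λ i → 2 * (D * g i) ≟ P i)
    ...   | no 2a≢P = inj₁ (halving-from (λ i → D * g i) a≤P Σa≡kD (InLattice-D* g) 2a≢P)
      where
      a≤P : ∀ i → D * g i ≤ P i
      a≤P i = ≤-trans (*-monoʳ-≤ D (g≤f i)) (subst (D * f i ≤_) (sym (P≡ i)) (m≤n+m _ (s i)))
      Σa≡kD : sum (λ i → D * g i) ≡ k * D
      Σa≡kD = trans (sym (*-distribˡ-sum D g)) (trans (cong (D *_) Σg≡k) (*-comm D k))
    ...   | yes 2a≡P = inj₂ (i , λ j j≢i →
              trans (sym (2a≡P j)) (cong (λ x → 2 * x) (trans (cong (D *_) (off j j≢i)) (*-zeroʳ D))))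
      where
      lemma : ∀ D g → 2 * (D * g) ≡ 2 * g * D
      lemma = solve-∀
      2g≡f : ∀ i → 2 * g i ≡ f i
      -- 2Dg = `P` makes every entry of `P` a multiple of `D`, with exact quotient 2g.
      2g≡f i = trans (sym (m*n/n≡m (2 * g i) D)) (cong (_/ D) (trans (sym (lemma D (g i))) (2a≡P i)))
      i = proj₁ (single 2g≡f)
      off = proj₂ (single 2g≡f)

    -- Summing `P+E≡` gives 2kD + ΣE = (n + Σf)D with ΣE > 0, so 2k < n + Σf. With n ≤ k + 2 this
    -- yields Σf ≥ k - 1, hence equality; then n + Σf ≤ 2k + 1 is tight as well, and ΣE = D.
    halving-by-orbit : 2 ≤ k → 2 ≤ n → n ≤ 2 + k → sum f < k → Halving (k * D) P
    halving-by-orbit 2≤k 2≤n n≤2+k Σf<k = halving-from a a≤P Σa≡kD La 2a≢P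
      where
      0<E : ∀ i → 0 < E i
      0<E i = m<n⇒0<n∸m (m%n<n (P i) D)
      0<sum : ∀ {n} → 2 ≤ n → (g : Vector ℕ n) → (∀ i → 0 < g i) → 0 < sum g
      0<sum (s≤s _) g 0<g = ≤-trans (0<g zero) (m≤m+n _ _)
      total : k * D + k * D + sum E ≡ (n + sum f) * D
      total = begin
        k * D + k * D + sum E        ≡⟨ cong (_+ sum E) ΣP≡2kD ⟨
        sum P + sum E                ≡⟨ ∑-distrib-+ P E ⟨
        sum (λ i → P i + E i)        ≡⟨ sum-cong-≗ P+E≡ ⟩
        sum (λ i → D * suc (f i))    ≡⟨ *-distribˡ-sum D (suc ∘ f) ⟨
        D * sum (suc ∘ f)            ≡⟨ cong (D *_) (sum-suc f) ⟩
        D * (n + sum f)              ≡⟨ *-comm D _ ⟩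
        (n + sum f) * D              ∎
        where open ≡-Reasoning
      2k<n+Σf : k + k < n + sum f
      2k<n+Σf = *-cancelʳ-< D _ _ (begin-strict
        (k + k) * D                ≡⟨ *-distribʳ-+ D k k ⟩
        k * D + k * D              <⟨ m<m+n _ (0<sum 2≤n E 0<E) ⟩
        k * D + k * D + sum E      ≡⟨ total ⟩
        (n + sum f) * D            ∎)
        where open ≤-Reasoning
      k≤1+Σf : k ≤ 1 + sum f
      k≤1+Σf = +-cancelˡ-≤ (1 + k) _ _ (begin
        1 + k + k            ≤⟨ 2k<n+Σf ⟩
        n + sum f            ≤⟨ +-monoˡ-≤ (sum f) n≤2+k ⟩
        2 + k + sum f        ≡⟨ +-suc (1 + k) (sum f) ⟨
        1 + k + (1 + sum f)  ∎)
        where open ≤-Reasoning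
      1+Σf≡k : 1 + sum f ≡ k
      1+Σf≡k = ≤-antisym Σf<k k≤1+Σf
      n+Σf≡1+2k : n + sum f ≡ 1 + (k + k)
      n+Σf≡1+2k = ≤-antisym
        (≤-pred (begin
          1 + (n + sum f)      ≡⟨ +-suc n (sum f) ⟨
          n + (1 + sum f)      ≡⟨ cong (_+_ n) 1+Σf≡k ⟩
          n + k                ≤⟨ +-monoˡ-≤ k n≤2+k ⟩
          2 + (k + k)          ∎))
        2k<n+Σf
        where open ≤-Reasoning
      ΣE≡D : sum E ≡ D
      ΣE≡D = +-cancelˡ-≡ (k * D + k * D) _ _ (begin
        k * D + k * D + sum E   ≡⟨ total ⟩
        (n + sum f) * D         ≡⟨ cong (_* D) n+Σf≡1+2k ⟩
        (1 + (k + k)) * D       ≡⟨ lemma k D ⟩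
        k * D + k * D + D       ∎)
        where
        open ≡-Reasoning
        lemma : ∀ k D → (1 + (k + k)) * D ≡ k * D + k * D + D
        lemma = solve-∀
      LE : InLattice E
      LE = InLattice-cancel P E (InLattice-cong (λ i → sym (P+E≡ i)) (InLattice-D* (suc ∘ f))) LP
      target : Target 2≤n E ΣE≡D LE
      -- The orbit starts at `r = E`, that is at t = 1 with nothing subtracted yet, which leaves
      -- `D − 1` steps.
      target = orbit 2≤n E ΣE≡D LE (D ∸ 1) 1 (m∸n+n≡m (>-nonZero⁻¹ D)) E 0<E ΣE≡D LE
        λ i → 0 , trans (cong (_+ E i) (*-zeroʳ D)) (sym (*-identityˡ (E i)))
      r = proj₁ target
      a : Vector ℕ n
      a i = r i + D * f i
      -- Comparing `r i + E i ≤ D` with `s i + E i ≡ D` gives `r i ≤ s i`.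
      a≤P : ∀ i → a i ≤ P i
      a≤P i = subst (a i ≤_) (sym (P≡ i)) (+-monoˡ-≤ (D * f i)
        (+-cancelʳ-≤ (E i) _ _ (subst (r i + E i ≤_) (sym (s+E≡D i)) (proj₁ (proj₂ target) i))))
      Σa≡kD : sum a ≡ k * D
      Σa≡kD = begin
        sum a                            ≡⟨ ∑-distrib-+ r _ ⟩
        sum r + sum (λ i → D * f i)      ≡⟨ cong₂ _+_ (proj₁ (proj₂ (proj₂ target))) (sym (*-distribˡ-sum D f)) ⟩
        D + D * sum f                    ≡⟨ *-suc D (sum f) ⟨
        D * (1 + sum f)                  ≡⟨ cong (D *_) 1+Σf≡k ⟩
        D * k                            ≡⟨ *-comm D k ⟩
        k * D                            ∎
        where open ≡-Reasoning
      La : InLattice a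
      La = InLattice-+ r (λ i → D * f i) (proj₂ (proj₂ (proj₂ target))) (InLattice-D* f)
      -- If 2a = `P`, removing `D * f i` once from both sides leaves 2r + Df = s < D. So `f`
      -- vanishes and k = 1 + Σf = 1, against 2 ≤ k.
      2a≢P : ¬ (∀ i → 2 * a i ≡ P i)
      2a≢P 2a≡P = <⇒≱ 2≤k (≤-reflexive (trans (sym 1+Σf≡k) (cong suc (sum-zero f f≡0))))
        where
        f≡0 : ∀ i → f i ≡ 0
        f≡0 i = n<1⇒n≡0 (*-cancelˡ-< D (f i) 1 (begin-strict
          D * f i              ≤⟨ m≤n+m _ (2 * r i) ⟩
          2 * r i + D * f i    ≡⟨ +-cancelʳ-≡ (D * f i) _ _ (trans (lemma (r i) (D * f i)) (trans (2a≡P i) (P≡ i))) ⟩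
          s i                  <⟨ m%n<n (P i) D ⟩
          D                    ≡⟨ *-identityʳ D ⟨
          D * 1                ∎))
          where
          open ≤-Reasoning
          lemma : ∀ x y → 2 * x + y + y ≡ 2 * (x + y)
          lemma = solve-∀

    halving⊎vertex : 2 ≤ k → 2 ≤ n → n ≤ 2 + k →
      Halving (k * D) P ⊎ ∃ λ i → ∀ j → j ≢ i → P j ≡ 0
    halving⊎vertex 2≤k 2≤n n≤2+k with k ≤? sum f
    ... | yes k≤Σf = halving-by-greedy (<⇒≤ 2≤k) k≤Σf
    ... | no  k≰Σf = inj₁ (halving-by-orbit 2≤k 2≤n n≤2+k (≰⇒> k≰Σf))

-- Rational convex combinations with cleared denominators

-- Arithmetic in `ℚ` normalises its results; the identity is therefore checked up to equivalence of
-- unnormalised fractions.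
fromℚᵘ-homo-+ : ∀ p q → ℚ.fromℚᵘ (p ℚᵘ.+ q) ≡ ℚ.fromℚᵘ p ℚ.+ ℚ.fromℚᵘ q
fromℚᵘ-homo-+ p q = ℚ.toℚᵘ-injective (begin
  ℚ.toℚᵘ (ℚ.fromℚᵘ (p ℚᵘ.+ q))                          ≈⟨ ℚ.toℚᵘ-fromℚᵘ (p ℚᵘ.+ q) ⟩
  p ℚᵘ.+ q                                              ≈⟨ ℚᵘ.+-cong (ℚ.toℚᵘ-fromℚᵘ p) (ℚ.toℚᵘ-fromℚᵘ q) ⟨
  ℚ.toℚᵘ (ℚ.fromℚᵘ p) ℚᵘ.+ ℚ.toℚᵘ (ℚ.fromℚᵘ q)          ≈⟨ ℚ.toℚᵘ-homo-+ (ℚ.fromℚᵘ p) (ℚ.fromℚᵘ q) ⟨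
  ℚ.toℚᵘ (ℚ.fromℚᵘ p ℚ.+ ℚ.fromℚᵘ q)                    ∎)
  where open ℚᵘ.≃-Reasoning

fromℚᵘ-homo-* : ∀ p q → ℚ.fromℚᵘ (p ℚᵘ.* q) ≡ ℚ.fromℚᵘ p ℚ.* ℚ.fromℚᵘ q
fromℚᵘ-homo-* p q = ℚ.toℚᵘ-injective (begin
  ℚ.toℚᵘ (ℚ.fromℚᵘ (p ℚᵘ.* q))                          ≈⟨ ℚ.toℚᵘ-fromℚᵘ (p ℚᵘ.* q) ⟩
  p ℚᵘ.* q                                              ≈⟨ ℚᵘ.*-cong (ℚ.toℚᵘ-fromℚᵘ p) (ℚ.toℚᵘ-fromℚᵘ q) ⟨
  ℚ.toℚᵘ (ℚ.fromℚᵘ p) ℚᵘ.* ℚ.toℚᵘ (ℚ.fromℚᵘ q)          ≈⟨ ℚ.toℚᵘ-homo-* (ℚ.fromℚᵘ p) (ℚ.fromℚᵘ q) ⟨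
  ℚ.toℚᵘ (ℚ.fromℚᵘ p ℚ.* ℚ.fromℚᵘ q)                    ∎)
  where open ℚᵘ.≃-Reasoning

toℚ-homo-* : ∀ x y → toℚ (x ℤ.* y) ≡ toℚ x ℚ.* toℚ y
toℚ-homo-* x y = fromℚᵘ-homo-* (mkℚᵘ x 0) (mkℚᵘ y 0)

toℚ-injective : ∀ {x y} → toℚ x ≡ toℚ y → x ≡ y
toℚ-injective {x} {y} eq with ℚ./-injective-≃ (mkℚᵘ x 0) (mkℚᵘ y 0) eq
... | *≡* x1≡y1 = trans (sym (ℤ.*-identityʳ x)) (trans x1≡y1 (ℤ.*-identityʳ y))

fromℕ : ℕ → ℚ
fromℕ k = toℚ (+ k)

fromℕ-homo-+ : ∀ k l → fromℕ (k + l) ≡ fromℕ k ℚ.+ fromℕ l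
fromℕ-homo-+ k l = trans
  -- Cross-multiplication over denominator 1 leaves the numerator k·1 + l·1.
  (cong toℚ (sym (cong₂ ℤ._+_ (ℤ.*-identityʳ (+ k)) (ℤ.*-identityʳ (+ l)))))
  (fromℚᵘ-homo-+ (mkℚᵘ (+ k) 0) (mkℚᵘ (+ l) 0))

fromℕ-homo-* : ∀ k l → fromℕ (k * l) ≡ fromℕ k ℚ.* fromℕ l
fromℕ-homo-* k l = trans (cong toℚ (ℤ.pos-* k l)) (toℚ-homo-* (+ k) (+ l))

fromℕ-injective : ∀ {k l} → fromℕ k ≡ fromℕ l → k ≡ l
fromℕ-injective = ℤ.+-injective ∘ toℚ-injective

fromℕ-*-/ : ∀ K .{{_ : NonZero K}} x → fromℕ K ℚ.* (x ℚ./ K) ≡ toℚ x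
fromℕ-*-/ (suc K) x = trans
  (sym (fromℚᵘ-homo-* (mkℚᵘ (+ suc K) 0) (mkℚᵘ x K)))
  (ℚ.fromℚᵘ-cong {mkℚᵘ (+ suc K) 0 ℚᵘ.* mkℚᵘ x K} {mkℚᵘ x 0} (*≡* (begin
    + suc K ℤ.* x ℤ.* + 1          ≡⟨ ℤ.*-identityʳ _ ⟩
    + suc K ℤ.* x                  ≡⟨ ℤ.*-comm (+ suc K) x ⟩
    x ℤ.* + suc K                  ≡⟨ cong (λ l → x ℤ.* + l) (+-identityʳ (suc K)) ⟨
    x ℤ.* + (1 * suc K)            ∎)))
  where open ≡-Reasoning

fromℕ-cancelˡ : ∀ K .{{_ : NonZero K}} {p q} → fromℕ K ℚ.* p ≡ fromℕ K ℚ.* q → p ≡ q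
fromℕ-cancelˡ K {p} {q} eq = trans (sym (inv p)) (trans (cong (K⁻¹ ℚ.*_) eq) (inv q))
  where
  K⁻¹ = + 1 ℚ./ K
  inv : ∀ x → K⁻¹ ℚ.* (fromℕ K ℚ.* x) ≡ x
  inv x = begin
    K⁻¹ ℚ.* (fromℕ K ℚ.* x)    ≡⟨ ℚ.*-assoc K⁻¹ (fromℕ K) x ⟨
    K⁻¹ ℚ.* fromℕ K ℚ.* x      ≡⟨ cong (ℚ._* x) (trans (ℚ.*-comm K⁻¹ (fromℕ K)) (fromℕ-*-/ K (+ 1))) ⟩
    1ℚ ℚ.* x                   ≡⟨ ℚ.*-identityˡ x ⟩
    x                          ∎
    where open ≡-Reasoning

sumℚ-cong : {f g : Fin m → ℚ} → (∀ i → f i ≡ g i) → sumℚ m f ≡ sumℚ m g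
sumℚ-cong {zero}  eq = refl
sumℚ-cong {suc m} eq = cong₂ ℚ._+_ (eq zero) (sumℚ-cong (eq ∘ suc))

*-distribˡ-sumℚ : ∀ c (f : Fin m → ℚ) → c ℚ.* sumℚ m f ≡ sumℚ m (λ i → c ℚ.* f i)
*-distribˡ-sumℚ {zero}  c f = ℚ.*-zeroʳ c
*-distribˡ-sumℚ {suc m} c f =
  trans (ℚ.*-distribˡ-+ c _ _) (cong (c ℚ.* f zero ℚ.+_) (*-distribˡ-sumℚ c (f ∘ suc)))

sumℚ-distrib-+ : (f g : Fin m → ℚ) → sumℚ m (λ i → f i ℚ.+ g i) ≡ sumℚ m f ℚ.+ sumℚ m g
sumℚ-distrib-+ {zero}  f g = refl
sumℚ-distrib-+ {suc m} f g =
  trans (cong (f zero ℚ.+ g zero ℚ.+_) (sumℚ-distrib-+ (f ∘ suc) (g ∘ suc)))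
        (interchange (f zero) (g zero) _ _)

sumℚ-fromℕ : (f : Vector ℕ m) → sumℚ m (fromℕ ∘ f) ≡ fromℕ (sum f)
sumℚ-fromℕ {zero}  f = refl
sumℚ-fromℕ {suc m} f =
  trans (cong (fromℕ (f zero) ℚ.+_) (sumℚ-fromℕ (f ∘ suc))) (sym (fromℕ-homo-+ (f zero) _))

sumℚ-fromℕ-· : (a x : Vector ℕ m) → sumℚ m (λ i → fromℕ (a i) ℚ.* fromℕ (x i)) ≡ fromℕ (a · x)
sumℚ-fromℕ-· a x =
  trans (sumℚ-cong (λ i → sym (fromℕ-homo-* (a i) (x i)))) (sumℚ-fromℕ (λ i → a i * x i))

+∣nonNeg∣ : ∀ {x} → x ≥ + 0 → x ≡ + ℤ.∣ x ∣
+∣nonNeg∣ x≥0 = sym (ℤ.0≤i⇒+∣i∣≡i x≥0)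

↥-nonNeg : ∀ p → 0ℚ ℚ.≤ p → ℚ.↥ p ≡ + ℤ.∣ ℚ.↥ p ∣
↥-nonNeg p 0≤p with ℚ.nonNegative 0≤p
↥-nonNeg (ℚ.mkℚ (+ _) _ _) _ | _ = refl

-- `D` is the product of all the reduced denominators, built up by induction.
common-denominator : (c : Fin m → ℚ) → (∀ i → 0ℚ ℚ.≤ c i) →
  ∃ λ D → NonZero D × ∃ λ (p : Vector ℕ m) → ∀ i → fromℕ D ℚ.* c i ≡ fromℕ (p i)
common-denominator {zero}  c 0≤c = 1 , _ , (λ ()) , λ ()
common-denominator {suc m} c 0≤c with common-denominator (c ∘ suc) (0≤c ∘ suc)
... | D , D≢0 , p , Dc≡p = d * D , m*n≢0 d D {{_}} {{D≢0}} , p′ , eq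
  where
  open ≡-Reasoning
  d = ℚ.↧ₙ (c zero)
  x = ℤ.∣ ℚ.↥ (c zero) ∣
  p′ : Vector ℕ (suc m)
  p′ zero    = D * x
  p′ (suc i) = d * p i
  dc≡x : fromℕ d ℚ.* c zero ≡ fromℕ x
  dc≡x = begin
    fromℕ d ℚ.* c zero                      ≡⟨ cong (fromℕ d ℚ.*_) (ℚ.↥p/↧p≡p (c zero)) ⟨
    fromℕ d ℚ.* (ℚ.↥ (c zero) ℚ./ d)        ≡⟨ fromℕ-*-/ d (ℚ.↥ (c zero)) ⟩
    toℚ (ℚ.↥ (c zero))                      ≡⟨ cong toℚ (↥-nonNeg (c zero) (0≤c zero)) ⟩
    fromℕ x                                 ∎
  eq : ∀ i → fromℕ (d * D) ℚ.* c i ≡ fromℕ (p′ i)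
  eq zero = begin
    fromℕ (d * D) ℚ.* c zero                ≡⟨ cong (λ l → fromℕ l ℚ.* c zero) (*-comm d D) ⟩
    fromℕ (D * d) ℚ.* c zero                ≡⟨ cong (ℚ._* c zero) (fromℕ-homo-* D d) ⟩
    fromℕ D ℚ.* fromℕ d ℚ.* c zero          ≡⟨ ℚ.*-assoc (fromℕ D) (fromℕ d) (c zero) ⟩
    fromℕ D ℚ.* (fromℕ d ℚ.* c zero)        ≡⟨ cong (fromℕ D ℚ.*_) dc≡x ⟩
    fromℕ D ℚ.* fromℕ x                     ≡⟨ fromℕ-homo-* D x ⟨
    fromℕ (D * x)                           ∎
  eq (suc i) = begin
    fromℕ (d * D) ℚ.* c (suc i)             ≡⟨ cong (ℚ._* c (suc i)) (fromℕ-homo-* d D) ⟩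
    fromℕ d ℚ.* fromℕ D ℚ.* c (suc i)       ≡⟨ ℚ.*-assoc (fromℕ d) (fromℕ D) (c (suc i)) ⟩
    fromℕ d ℚ.* (fromℕ D ℚ.* c (suc i))     ≡⟨ cong (fromℕ d ℚ.*_) (Dc≡p i) ⟩
    fromℕ d ℚ.* fromℕ (p i)                 ≡⟨ fromℕ-homo-* d (p i) ⟨
    fromℕ (d * p i)                         ∎

scaled-weights : ∀ D (c : Fin m → ℚ) (p : Vector ℕ m) → (∀ i → fromℕ D ℚ.* c i ≡ fromℕ (p i)) →
  fromℕ D ℚ.* sumℚ m c ≡ fromℕ (sum p)
scaled-weights D c p Dc≡p =
  trans (*-distribˡ-sumℚ (fromℕ D) c) (trans (sumℚ-cong Dc≡p) (sumℚ-fromℕ p))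

module _ (v : Fin m → Point n) (v′ : Fin m → Vector ℕ n) (v≡ : ∀ i j → v i j ≡ + v′ i j) where

  scaled-combination : ∀ D (c : Fin m → ℚ) (p : Vector ℕ m) → (∀ i → fromℕ D ℚ.* c i ≡ fromℕ (p i)) →
    ∀ j → fromℕ D ℚ.* sumℚ m (λ i → c i ℚ.* toℚ (v i j)) ≡ fromℕ (p · (λ i → v′ i j))
  scaled-combination D c p Dc≡p j = begin
    fromℕ D ℚ.* sumℚ m (λ i → c i ℚ.* toℚ (v i j))      ≡⟨ *-distribˡ-sumℚ (fromℕ D) (λ i → c i ℚ.* toℚ (v i j)) ⟩
    sumℚ m (λ i → fromℕ D ℚ.* (c i ℚ.* toℚ (v i j)))    ≡⟨ sumℚ-cong (λ i → sym (ℚ.*-assoc (fromℕ D) (c i) _)) ⟩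
    sumℚ m (λ i → fromℕ D ℚ.* c i ℚ.* toℚ (v i j))      ≡⟨ sumℚ-cong (λ i → cong₂ ℚ._*_ (Dc≡p i) (cong toℚ (v≡ i j))) ⟩
    sumℚ m (λ i → fromℕ (p i) ℚ.* fromℕ (v′ i j))       ≡⟨ sumℚ-fromℕ-· p (λ i → v′ i j) ⟩
    fromℕ (p · (λ i → v′ i j))                          ∎
    where open ≡-Reasoning

  -- The convex weights are `a i / K`; both equations are verified after multiplication by `K`.
  InConv⁺ : ∀ {z : Point n} K .{{_ : NonZero K}} (a : Vector ℕ m) (z′ : Vector ℕ n) →
    (∀ j → z j ≡ + z′ j) → sum a ≡ K → (∀ j → a · (λ i → v′ i j) ≡ K * z′ j) → InConv v z
  InConv⁺ {z} K a z′ z≡ Σa≡K av≡Kz = c , c≥0 , Σc≡1 , cv≡z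
    where
    c : Fin m → ℚ
    c i = + a i ℚ./ K
    Kc≡a : ∀ i → fromℕ K ℚ.* c i ≡ fromℕ (a i)
    Kc≡a i = fromℕ-*-/ K (+ a i)
    c≥0 : ∀ i → 0ℚ ℚ.≤ c i
    c≥0 i = ℚ.nonNegative⁻¹ (c i) {{ℚ.normalize-nonNeg (a i) K}}
    Σc≡1 : sumℚ m c ≡ 1ℚ
    Σc≡1 = fromℕ-cancelˡ K (trans (scaled-weights K c a Kc≡a)
      (trans (cong fromℕ Σa≡K) (sym (ℚ.*-identityʳ (fromℕ K)))))
    cv≡z : ∀ j → sumℚ m (λ i → c i ℚ.* toℚ (v i j)) ≡ toℚ (z j)
    cv≡z j = fromℕ-cancelˡ K (trans (scaled-combination K c a Kc≡a j)
      (trans (cong fromℕ (av≡Kz j)) (trans (fromℕ-homo-* K (z′ j))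
        (cong (λ x → fromℕ K ℚ.* toℚ x) (sym (z≡ j))))))

  InConv⁻ : ∀ {y : Point n} → InConv v y →
    ∃ λ D → NonZero D × ∃ λ (p : Vector ℕ m) → ∃ λ (y′ : Vector ℕ n) →
      (∀ j → y j ≡ + y′ j) × sum p ≡ D × (∀ j → p · (λ i → v′ i j) ≡ D * y′ j)
  InConv⁻ {y} (c , 0≤c , Σc≡1 , cv≡y) with common-denominator c 0≤c
  ... | D , D≢0 , p , Dc≡p = D , D≢0 , p , y′ , y≡ , Σp≡D , pv≡Dy
    where
    y′ : Vector ℕ n
    y′ j = ℤ.∣ y j ∣
    Dy≡pv : ∀ j → + D ℤ.* y j ≡ + (p · (λ i → v′ i j))
    Dy≡pv j = toℚ-injective (trans (toℚ-homo-* (+ D) (y j))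
      (trans (cong (fromℕ D ℚ.*_) (sym (cv≡y j))) (scaled-combination D c p Dc≡p j)))
    -- `D` times `y j` is a sum of naturals and `D` is positive, so `y j` is nonnegative.
    y≡ : ∀ j → y j ≡ + y′ j
    y≡ j = +∣nonNeg∣ (ℤ.*-cancelˡ-≤-pos (+ 0) (y j) (+ D) {{ℤ.positive (ℤ.+<+ (>-nonZero⁻¹ D {{D≢0}}))}}
      (subst₂ ℤ._≤_ (sym (ℤ.*-zeroʳ (+ D))) (sym (Dy≡pv j)) (ℤ.+≤+ z≤n)))
    Σp≡D : sum p ≡ D
    Σp≡D = fromℕ-injective (trans (sym (scaled-weights D c p Dc≡p))
      (trans (cong (fromℕ D ℚ.*_) Σc≡1) (ℚ.*-identityʳ (fromℕ D))))
    pv≡Dy : ∀ j → p · (λ i → v′ i j) ≡ D * y′ j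
    pv≡Dy j = ℤ.+-injective (trans (sym (Dy≡pv j))
      (trans (cong (+ D ℤ.*_) (y≡ j)) (sym (ℤ.pos-* D (y′ j)))))

  -- Independence is applied to the difference `c` = a - b. Each of its sums vanishes because adding
  -- the corresponding sum for `b` gives the one for `a`, which has the same value.
  affine-weights-unique : AffinelyIndependent v → (a b : Vector ℕ m) → sum a ≡ sum b →
    (∀ j → a · (λ i → v′ i j) ≡ b · (λ i → v′ i j)) → ∀ i → a i ≡ b i
  affine-weights-unique indep a b Σa≡Σb av≡bv i = fromℕ-injective (begin
    fromℕ (a i)                 ≡⟨ c+b≡a i ⟨
    c i ℚ.+ fromℕ (b i)         ≡⟨ cong (ℚ._+ fromℕ (b i)) (indep c Σc≡0 cv≡0 i) ⟩
    0ℚ ℚ.+ fromℕ (b i)          ≡⟨ ℚ.+-identityˡ _ ⟩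
    fromℕ (b i)                 ∎)
    where
    open ≡-Reasoning
    c : Fin m → ℚ
    c i = fromℕ (a i) ℚ.- fromℕ (b i)
    c+b≡a : ∀ i → c i ℚ.+ fromℕ (b i) ≡ fromℕ (a i)
    c+b≡a i = trans (ℚ.+-assoc (fromℕ (a i)) _ _)
      (trans (cong (fromℕ (a i) ℚ.+_) (ℚ.+-inverseˡ (fromℕ (b i)))) (ℚ.+-identityʳ _))
    Σc≡0 : sumℚ m c ≡ 0ℚ
    Σc≡0 = identityˡ-unique _ _ (begin
      sumℚ m c ℚ.+ fromℕ (sum b)             ≡⟨ cong (sumℚ m c ℚ.+_) (sumℚ-fromℕ b) ⟨
      sumℚ m c ℚ.+ sumℚ m (fromℕ ∘ b)        ≡⟨ sumℚ-distrib-+ c (fromℕ ∘ b) ⟨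
      sumℚ m (λ i → c i ℚ.+ fromℕ (b i))     ≡⟨ sumℚ-cong c+b≡a ⟩
      sumℚ m (fromℕ ∘ a)                     ≡⟨ sumℚ-fromℕ a ⟩
      fromℕ (sum a)                          ≡⟨ cong fromℕ Σa≡Σb ⟩
      fromℕ (sum b)                          ∎)
    cv≡0 : ∀ j → sumℚ m (λ i → c i ℚ.* toℚ (v i j)) ≡ 0ℚ
    cv≡0 j = identityˡ-unique _ _ (begin
      sumℚ m (λ i → c i ℚ.* toℚ (v i j)) ℚ.+ fromℕ (b · x)
        ≡⟨ cong₂ ℚ._+_ (sumℚ-cong (λ i → cong (λ z → c i ℚ.* toℚ z) (v≡ i j))) (sym (sumℚ-fromℕ-· b x)) ⟩
      sumℚ m (λ i → c i ℚ.* fromℕ (x i)) ℚ.+ sumℚ m (λ i → fromℕ (b i) ℚ.* fromℕ (x i))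
        ≡⟨ sumℚ-distrib-+ (λ i → c i ℚ.* fromℕ (x i)) (λ i → fromℕ (b i) ℚ.* fromℕ (x i)) ⟨
      sumℚ m (λ i → c i ℚ.* fromℕ (x i) ℚ.+ fromℕ (b i) ℚ.* fromℕ (x i))
        ≡⟨ sumℚ-cong (λ i → trans (sym (ℚ.*-distribʳ-+ (fromℕ (x i)) (c i) (fromℕ (b i))))
                                   (cong (ℚ._* fromℕ (x i)) (c+b≡a i))) ⟩
      sumℚ m (λ i → fromℕ (a i) ℚ.* fromℕ (x i))
        ≡⟨ sumℚ-fromℕ-· a x ⟩
      fromℕ (a · x)
        ≡⟨ cong fromℕ (av≡bv j) ⟩
      fromℕ (b · x) ∎)
      where
      x : Vector ℕ m
      x i = v′ i j

-- Midpoints in the dilated simplex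

even-doubled : (q : Vector ℕ n) → EvenPoint (λ j → + (2 * q j))
even-doubled q j = divides (q j) (*-comm 2 (q j))

module _ (k : ℕ) (2≤k : 2 ≤ k) (u : Fin m → Point n) (w : Fin m → Vector ℕ n)
         (u≡2w : ∀ i j → u i j ≡ + (2 * w i j)) where

  -- The factor 2k stands in front so that `·-comm-*` can move it from the vertices to the weights.
  v′ : Fin m → Vector ℕ n
  v′ i j = 2 * k * w i j

  v≡ : ∀ i j → scale k u i j ≡ + v′ i j
  v≡ i j = begin
    + k ℤ.* u i j              ≡⟨ cong (+ k ℤ.*_) (u≡2w i j) ⟩
    + k ℤ.* + (2 * w i j)      ≡⟨ ℤ.pos-* k (2 * w i j) ⟨
    + (k * (2 * w i j))        ≡⟨ cong +_ (lemma k (w i j)) ⟩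
    + v′ i j                   ∎
    where
    open ≡-Reasoning
    lemma : ∀ k x → k * (2 * x) ≡ 2 * k * x
    lemma = solve-∀

  vertex∈ : ∀ i → InConv (scale k u) (scale k u i)
  vertex∈ i = InConv⁺ (scale k u) v′ v≡ 1 (δ i) (v′ i) (v≡ i) (sum-δ i)
    (λ j → trans (·-δ i (λ l → v′ l j)) (sym (*-identityˡ _)))

  Mediates : Point n → Set
  Mediates y = ∃ λ (z₁ : Point n) → ∃ λ (z₂ : Point n) →
    InConv (scale k u) z₁ × InConv (scale k u) z₂ × EvenPoint z₁ × EvenPoint z₂ × ¬ (z₁ ≡ z₂) ×
    (∀ j → + 2 ℤ.* y j ≡ z₁ j ℤ.+ z₂ j)

  module _ (D : ℕ) .{{_ : NonZero D}} (p : Vector ℕ m) (Σp≡D : sum p ≡ D)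
           (y : Point n) (y′ : Vector ℕ n) (y≡ : ∀ j → y j ≡ + y′ j)
           (pv≡Dy : ∀ j → p · (λ i → v′ i j) ≡ D * y′ j) where

    -- The barycentric weights `p i / D` of `y` in the dilated simplex give λᵢ = k pᵢ / D, so `P` =
    -- 2λD. As u = 2w, combining `w` with `P` yields `D` times `y`; integrality of `y` thus puts `P`
    -- in the lattice.
    P : Vector ℕ m
    P i = 2 * k * p i

    Pw≡Dy : ∀ j → P · (λ i → w i j) ≡ D * y′ j
    Pw≡Dy j = trans (·-assoc-* (2 * k) p (λ i → w i j))
      (trans (sym (·-comm-* (2 * k) p (λ i → w i j))) (pv≡Dy j))

    LP : InLattice D w P
    LP j = subst (D ∣_) (sym (Pw≡Dy j)) (m∣m*n (y′ j))

    ΣP≡ : sum P ≡ k * D + k * D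
    ΣP≡ = trans (sym (*-distribˡ-sum (2 * k) p)) (trans (cong (_*_ (2 * k)) Σp≡D) (lemma k D))
      where
      lemma : ∀ k D → 2 * k * D ≡ k * D + k * D
      lemma = solve-∀

    kD≢0 : NonZero (k * D)
    kD≢0 = m*n≢0 k D {{>-nonZero (<⇒≤ 2≤k)}}

    -- Dividing `a` by `kD` gives barycentric weights for the vertices 2kw, and their combination is
    -- 2k · qD / (kD) = 2q.
    doubled∈ : (a : Vector ℕ m) (q : Vector ℕ n) → sum a ≡ k * D → (∀ j → a · (λ i → w i j) ≡ q j * D) →
      InConv (scale k u) (λ j → + (2 * q j))
    doubled∈ a q Σa≡kD aw≡qD = InConv⁺ (scale k u) v′ v≡ (k * D) {{kD≢0}} a (λ j → 2 * q j) (λ _ → refl) Σa≡kD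
      (λ j → trans (·-comm-* (2 * k) a (λ i → w i j))
        (trans (cong (_*_ (2 * k)) (aw≡qD j)) (lemma k (q j) D)))
      where
      lemma : ∀ k q D → 2 * k * (q * D) ≡ k * D * (2 * q)
      lemma = solve-∀

    vertex-of-support : (i : Fin m) → (∀ j → j ≢ i → P j ≡ 0) → ∀ j → y j ≡ scale k u i j
    vertex-of-support i off j = trans (y≡ j) (trans (cong +_ (y′≡ j)) (sym (v≡ i j)))
      where
      p-off : ∀ j → j ≢ i → p j ≡ 0
      p-off j j≢i = m*n≡0⇒m≡0 (p j) (2 * k) {{m*n≢0 2 k {{_}} {{>-nonZero (<⇒≤ 2≤k)}}}}
        (trans (*-comm (p j) (2 * k)) (off j j≢i))
      y′≡ : ∀ j → y′ j ≡ v′ i j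
      y′≡ j = *-cancelˡ-≡ (y′ j) (v′ i j) D (begin
        D * y′ j                   ≡⟨ pv≡Dy j ⟨
        p · (λ l → v′ l j)         ≡⟨ ·-single p (λ l → v′ l j) i p-off ⟩
        p i * v′ i j               ≡⟨ cong (_* v′ i j) (trans (sym (sum-single p i p-off)) Σp≡D) ⟩
        D * v′ i j                 ∎)
        where open ≡-Reasoning

    -- The divisibility quotients `q` and `q′` are half the coordinates of the two points, so
    -- evenness is built in.
    mediates-of-halving : AffinelyIndependent u → Halving D w (k * D) P → Mediates y
    mediates-of-halving indep (a , b , a+b≡P , Σa≡kD , Σb≡kD , La , Lb , a≢b) =
      (λ j → + (2 * q j)) , (λ j → + (2 * q′ j)) ,
      doubled∈ a q Σa≡kD aw≡ , doubled∈ b q′ Σb≡kD bw≡ ,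
      even-doubled q , even-doubled q′ , distinct , midpoint
      where
      q q′ : Vector ℕ n
      q j  = _∣_.quotient (La j)
      q′ j = _∣_.quotient (Lb j)
      aw≡ : ∀ j → a · (λ i → w i j) ≡ q j * D
      aw≡ j = _∣_.equality (La j)
      bw≡ : ∀ j → b · (λ i → w i j) ≡ q′ j * D
      bw≡ j = _∣_.equality (Lb j)
      q+q′≡y′ : ∀ j → q j + q′ j ≡ y′ j
      q+q′≡y′ j = *-cancelʳ-≡ (q j + q′ j) (y′ j) D (begin
        (q j + q′ j) * D                             ≡⟨ *-distribʳ-+ D (q j) (q′ j) ⟩
        q j * D + q′ j * D                           ≡⟨ cong₂ _+_ (aw≡ j) (bw≡ j) ⟨
        a · (λ i → w i j) + b · (λ i → w i j)        ≡⟨ ·-distribʳ-+ a b (λ i → w i j) ⟨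
        (λ i → a i + b i) · (λ i → w i j)            ≡⟨ ·-congˡ (λ i → w i j) a+b≡P ⟩
        P · (λ i → w i j)                            ≡⟨ Pw≡Dy j ⟩
        D * y′ j                                     ≡⟨ *-comm D (y′ j) ⟩
        y′ j * D                                     ∎)
        where open ≡-Reasoning
      midpoint : ∀ j → + 2 ℤ.* y j ≡ + (2 * q j) ℤ.+ + (2 * q′ j)
      midpoint j = begin
        + 2 ℤ.* y j                  ≡⟨ cong (+ 2 ℤ.*_) (y≡ j) ⟩
        + 2 ℤ.* + y′ j               ≡⟨ ℤ.pos-* 2 (y′ j) ⟨
        + (2 * y′ j)                 ≡⟨ cong (λ x → + (2 * x)) (q+q′≡y′ j) ⟨
        + (2 * (q j + q′ j))         ≡⟨ cong +_ (*-distribˡ-+ 2 (q j) (q′ j)) ⟩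
        + (2 * q j + 2 * q′ j)       ∎
        where open ≡-Reasoning
      distinct : ¬ ((λ j → + (2 * q j)) ≡ (λ j → + (2 * q′ j)))
      -- Equal points come from weight vectors of equal sum with equal combinations of the `u i`, so
      -- independence would force `a` = `b`.
      distinct eq = a≢b (affine-weights-unique u (λ i j → 2 * w i j) u≡2w indep a b (trans Σa≡kD (sym Σb≡kD)) λ j →
        trans (·-comm-* 2 a (λ i → w i j)) (trans (cong (_*_ 2) (aw≡bw j)) (sym (·-comm-* 2 b (λ i → w i j)))))
        where
        aw≡bw : ∀ j → a · (λ i → w i j) ≡ b · (λ i → w i j)
        aw≡bw j = trans (aw≡ j) (trans (cong (_* D)
          (*-cancelˡ-≡ (q j) (q′ j) 2 (ℤ.+-injective (cong-app eq j)))) (sym (bw≡ j)))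

    vertex⊎mediates : AffinelyIndependent u → 2 ≤ m → m ≤ 2 + k →
      (∃ λ i → ∀ j → y j ≡ scale k u i j) ⊎ Mediates y
    vertex⊎mediates indep 2≤m m≤2+k =
      [ (λ h → inj₂ (mediates-of-halving indep h)) , (λ (i , off) → inj₁ (i , vertex-of-support i off)) ]′
        (halving⊎vertex D w P LP k ΣP≡ 2≤k 2≤m m≤2+k)

  mediated : AffinelyIndependent u → 2 ≤ m → m ≤ 2 + k → Mediated (scale k u) (LatticePoints (scale k u))
  mediated indep 2≤m m≤2+k = (λ y y∈ → y∈) , vertex∈ , λ y y∈ →
    let D , D≢0 , p , y′ , y≡ , Σp≡D , pv≡Dy = InConv⁻ (scale k u) v′ v≡ y∈
    in vertex⊎mediates D {{D≢0}} p Σp≡D y y′ y≡ pv≡Dy indep 2≤m m≤2+k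

theorem3p1 : (n d : ℕ) → 2 ≤ n → 1 ≤ d →
    (u : Fin n → Point n) →
    (∀ i j → u i j ≥ + 0) →
    (∀ i → EvenPoint (u i)) →
    (∀ i → coordSum n (u i) ≡ + (2 * d)) →
    AffinelyIndependent u →
    (k : ℕ) → 2 ≤ k → n ∸ 2 ≤ k →
    Mediated (scale k u) (LatticePoints (scale k u))
theorem3p1 n d 2≤n 1≤d u u≥0 u-even Σu≡2d indep k 2≤k n∸2≤k =
  -- Since n ≤ 2 + (n ∸ 2), the truncated bound on `k` becomes n ≤ 2 + k.
  mediated k 2≤k u w u≡2w indep 2≤n (≤-trans (m≤n+m∸n n 2) (+-monoʳ-≤ 2 n∸2≤k))
  where
  w : Fin n → Vector ℕ n
  -- Integer divisibility is divisibility of absolute values, so this quotient is already a natural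
  -- number.
  w i j = _∣_.quotient (u-even i j)
  u≡2w : ∀ i j → u i j ≡ + (2 * w i j)
  u≡2w i j = trans (+∣nonNeg∣ (u≥0 i j)) (cong +_ (trans (_∣_.equality (u-even i j)) (*-comm (w i j) 2)))
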